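{- Let $S$ be a finite set and let $p\notin S$. Let $\mathrm{Semimat}(S)$ be the set of semimatroids on $S$, and let $\mathrm{Pointedmat}(S,p)$ be the set of pairs $(\widetilde{N},p)$ where $\widetilde{N}$ is a matroid on $S\cup\{p\}$ such that $p$ is not a loop of $\widetilde{N}$. 1. For $(\widetilde{N},p)\in\mathrm{Pointedmat}(S,p)$, let $\mathcal{C}=\{A\subseteq S\mid p\notin \mathrm{cl}_{\widetilde{N}}(A)\}$ and let $r_{\mathcal{C}}$ be the restriction of $r_{\widetilde{N}}$ to $\mathcal{C}$. Then $(S,\mathcal{C},r_{\mathcal{C}})$ is a semimatroid. 2. For $(S,\mathcal{C},r_{\mathcal{C}})\in\mathrm{Semimat}(S)$, define $r_{\widetilde{N}}:2^{S\cup\{p\}}\to\mathbb{N}$ by $$r_{\widetilde{N}}(A)=\begin{cases} r_{\mathcal{C}}(A) & \text{if } A\in\mathcal{C},\\ \max\{r_{\mathcal{C}}(B)\mid B\subseteq A,\ B\in\mathcal{C}\}+1 & \text{if } A\notin\mathcal{C},\end{cases}$$ $$r_{\widetilde{N}}(A\cup\{p\})=\begin{cases} r_{\widetilde{N}}(A)+1 & \text{if } A\in\mathcal{C},\\ r_{\widetilde{N}}(A) & \text{if } A\notin\mathcal{C},\end{cases}$$ for $A\subseteq S$. Then $r_{\widetilde{N}}$ is the rank function of a matroid $\widetilde{N}$ on $S\cup\{p\}$, and $(\widetilde{N},p)\in\mathrm{Pointedmat}(S,p)$. 3. The map $\mathrm{Pointedmat}(S,p)\to\mathrm{Semimat}(S)$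 sending $(\widetilde{N},p)$ to the semimatroid $(S,\mathcal{C},r_{\mathcal{C}})$ with $\mathcal{C}=\{A\subseteq S\mid p\notin \mathrm{cl}_{\widetilde{N}}(A)\}$ and $r_{\mathcal{C}}=r_{\widetilde{N}}|_{\mathcal{C}}$, and the map $\mathrm{Semimat}(S)\to\mathrm{Pointedmat}(S,p)$ sending $(S,\mathcal{C},r_{\mathcal{C}})$ to the pair $(\widetilde{N},p)$, where $\widetilde{N}$ is the matroid on $S\cup\{p\}$ whose rank function is given, for $A\subseteq S$, by $r_{\widetilde{N}}(A)=r_{\mathcal{C}}(A)$ and $r_{\widetilde{N}}(A\cup\{p\})=r_{\mathcal{C}}(A)+1$ if $A\in\mathcal{C}$, and by $r_{\widetilde{N}}(A)=r_{\widetilde{N}}(A\cup\{p\})=\max\{r_{\mathcal{C}}(B)\mid B\subseteq A,\ B\in\mathcal{C}\}+1$ if $A\notin\mathcal{C}$, are inverses. They establish a one-to-one correspondence between $\mathrm{Pointedmat}(S,p)$ and $\mathrm{Semimat}(S)$.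
   Context: $\mathbb{N}$ includes $0$. A simplicial complex on a finite set $S$ is a family of subsets of $S$ closed under taking subsets; singletons need not belong to it. A semimatroid is a triple $(S,\mathcal{C},r_{\mathcal{C}})$ consisting of a finite set $S$, a non-empty simplicial complex $\mathcal{C}$ on $S$, and a function $r_{\mathcal{C}}:\mathcal{C}\to\mathbb{N}$ such that: (R1) if $X\in\mathcal{C}$ then $0\le r_{\mathcal{C}}(X)\le |X|$; (R2) if $X,Y\in\mathcal{C}$ and $X\subseteq Y$ then $r_{\mathcal{C}}(X)\le r_{\mathcal{C}}(Y)$; (R3) if $X,Y\in\mathcal{C}$ and $X\cup Y\in\mathcal{C}$ then $r_{\mathcal{C}}(X)+r_{\mathcal{C}}(Y)\ge r_{\mathcal{C}}(X\cup Y)+r_{\mathcal{C}}(X\cap Y)$; (CR1) if $X,Y\in\mathcal{C}$ and $r_{\mathcal{C}}(X)=r_{\mathcal{C}}(X\cap Y)$ then $X\cup Y\in\mathcal{C}$; (CR2) if $X,Y\in\mathcal{C}$ and $r_{\mathcal{C}}(X)<r_{\mathcal{C}}(Y)$ then $X\cup\{y\}\in\mathcal{C}$ for some $y\in Y-X$. For a matroid $\widetilde{N}$, $r_{\widetilde{N}}$ is its rank function and $\mathrm{cl}_{\widetilde{N}}$ its closure operator. -}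

module Defs where

open import Data.Fin.Base using (Fin; zero; suc)
open import Data.Fin.Subset
  using (Subset; inside; outside; _∈_; _∉_; _⊆_; _∪_; _∩_; _─_; ⁅_⁆; ∣_∣)
open import Data.Fin.Subset.Properties using (_∈?_; _⊆?_; p∩q⊆p)
open import Data.List.Base using (List; []; _∷_; _++_; map; mapMaybe)
open import Data.List.Extrema.Nat using (max)
import Data.Maybe.Base as Maybe
open import Data.Nat.Base using (ℕ; zero; suc; _+_; _≤_; _<_)
open import Data.Nat.Properties using (_≟_)
open import Data.Product.Base using (∃-syntax; _×_; _,_)
open import Data.Vec.Base using ([]; _∷_; tabulate)
open import Level using (0ℓ)
import Level
open import Relation.Binary.Core using (Rel)
open import Relation.Binary.PropositionalEquality using (_≡_; _≗_)
open import Relation.Nullary using (yes; no; does; ¬_)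
open import Relation.Nullary.Decidable using (¬?; _×-dec_; dec⇒maybe)
open import Relation.Unary using (Pred; Decidable; Satisfiable; _≐_)

record IsMatroidRank {m : ℕ} (r : Subset m → ℕ) : Set where
  field
    bounded    : ∀ X → r X ≤ ∣ X ∣
    monotone   : ∀ {X Y} → X ⊆ Y → r X ≤ r Y
    submodular : ∀ X Y → r (X ∪ Y) + r (X ∩ Y) ≤ r X + r Y

record Matroid (m : ℕ) : Set where
  field
    rank          : Subset m → ℕ
    isMatroidRank : IsMatroidRank rank

  cl : Subset m → Subset m
  cl A = tabulate λ x → does (rank (A ∪ ⁅ x ⁆) ≟ rank A)

  IsLoop : Fin m → Set
  IsLoop x = rank ⁅ x ⁆ ≡ 0

-- The ground set S is Fin n.  A family of subsets of S is a decidable predicate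
-- on Subset n, so that "A ∈ 𝒞 or A ∉ 𝒞" is available as it is classically.
-- The rank function lives on 𝒞 only; its membership argument is irrelevant,
-- so that the value depends on the set alone.
record IsSemimatroid {n : ℕ} (𝒞 : Pred (Subset n) 0ℓ)
                     (r : ∀ X → .(𝒞 X) → ℕ) : Set where
  field
    𝒞?       : Decidable 𝒞
    nonEmpty : Satisfiable 𝒞
    closed   : ∀ {X Y} → X ⊆ Y → 𝒞 Y → 𝒞 X
    R1  : ∀ X (x : 𝒞 X) → r X x ≤ ∣ X ∣
    R2  : ∀ {X Y} (x : 𝒞 X) (y : 𝒞 Y) → X ⊆ Y → r X x ≤ r Y y
    R3  : ∀ {X Y} (x : 𝒞 X) (y : 𝒞 Y) (xy : 𝒞 (X ∪ Y)) →
          r (X ∪ Y) xy + r (X ∩ Y) (closed (p∩q⊆p X Y) x) ≤ r X x + r Y y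
    CR1 : ∀ {X Y} (x : 𝒞 X) → 𝒞 Y →
          r X x ≡ r (X ∩ Y) (closed (p∩q⊆p X Y) x) → 𝒞 (X ∪ Y)
    CR2 : ∀ {X Y} (x : 𝒞 X) (y : 𝒞 Y) → r X x < r Y y →
          ∃[ e ] e ∈ Y ─ X × 𝒞 (X ∪ ⁅ e ⁆)

record Semimat (n : ℕ) : Set (Level.suc 0ℓ) where
  field
    𝒞             : Pred (Subset n) 0ℓ
    rank          : ∀ X → .(𝒞 X) → ℕ
    isSemimatroid : IsSemimatroid 𝒞 rank
  open IsSemimatroid isSemimatroid public

infix 4 _≈ˢ_ _≈ᵖ_

_≈ˢ_ : ∀ {n} → Rel (Semimat n) 0ℓ
M ≈ˢ M′ = M.𝒞 ≐ M′.𝒞 × (∀ X (c : M.𝒞 X) (c′ : M′.𝒞 X) → M.rank X c ≡ M′.rank X c′)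
  where
  module M  = Semimat M
  module M′ = Semimat M′

-- S ∪ {p} is Fin (suc n): p is zero, and each element i of S becomes suc i.
-- For A ⊆ S, the subsets A and A ∪ {p} of S ∪ {p} are
-- outside ∷ A and inside ∷ A respectively.
p : ∀ {n} → Fin (suc n)
p = zero

record Pointedmat (n : ℕ) : Set where
  field
    matroid   : Matroid (suc n)
  open Matroid matroid public
  field
    p-nonloop : ¬ IsLoop p

_≈ᵖ_ : ∀ {n} → Rel (Pointedmat n) 0ℓ
N ≈ᵖ N′ = Pointedmat.rank N ≗ Pointedmat.rank N′

module _ {n : ℕ} (N : Pointedmat n) where
  open Pointedmat N

  avoiding : Pred (Subset n) 0ℓ
  avoiding A = p ∉ cl (outside ∷ A)

  restrictedRank : ∀ A → .(avoiding A) → ℕ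
  restrictedRank A _ = rank (outside ∷ A)

  semimatroidOf : IsSemimatroid avoiding restrictedRank → Semimat n
  semimatroidOf h = record
    { 𝒞 = avoiding ; rank = restrictedRank ; isSemimatroid = h }

subsets : ∀ n → List (Subset n)
subsets zero    = [] ∷ []
subsets (suc n) = map (outside ∷_) (subsets n) ++ map (inside ∷_) (subsets n)

module _ {n : ℕ} (M : Semimat n) where
  open Semimat M

  -- max { rank B ∣ B ⊆ A, B ∈ 𝒞 }.  This set of ranks contains the rank of the
  -- empty set, so the default value 0 passed to max does not affect the result.
  maxRank : Subset n → ℕ
  maxRank A = max 0 (mapMaybe rankBelow (subsets n))
    where
    rankBelow : Subset n → Maybe.Maybe ℕ
    rankBelow B = Maybe.map (λ (_ , c) → rank B c) (dec⇒maybe (B ⊆? A ×-dec 𝒞? B))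

  extendedRank : Subset (suc n) → ℕ
  extendedRank (outside ∷ A) with 𝒞? A
  ... | yes c = rank A c
  ... | no _  = maxRank A + 1
  extendedRank (inside ∷ A) with 𝒞? A
  ... | yes _ = extendedRank (outside ∷ A) + 1
  ... | no _  = extendedRank (outside ∷ A)

  extendedMatroid : IsMatroidRank extendedRank → Matroid (suc n)
  extendedMatroid h = record { rank = extendedRank ; isMatroidRank = h }

  pointedmatOf : (h : IsMatroidRank extendedRank) →
                 ¬ Matroid.IsLoop (extendedMatroid h) p → Pointedmat n
  pointedmatOf h nonloop = record { matroid = extendedMatroid h ; p-nonloop = nonloop }

  HasRankGivenBy : Pointedmat n → Set
  HasRankGivenBy N = ∀ A →
    (∀ (c : 𝒞 A) → N.rank (outside ∷ A) ≡ rank A c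
                 × N.rank (inside  ∷ A) ≡ rank A c + 1)
    × (¬ 𝒞 A → N.rank (outside ∷ A) ≡ maxRank A + 1
             × N.rank (inside  ∷ A) ≡ maxRank A + 1)
    where module N = Pointedmat N

{-# OPTIONS --safe #-}
module Submission where

-- Write ρ A = r(A) and σ A = r(A ∪ {p}) for A ⊆ S.  Then p ∉ cl A means σ A = ρ A + 1,
-- and part 1 follows from submodularity.  For part 2, the extended rank of A is
-- maxRank A plus an excess, which is 0 if A ∈ 𝒞 and 1 otherwise, and the extended
-- rank of A ∪ {p} is maxRank A + 1.  By CR2 every D ∈ 𝒞 inside A grows to a B ∈ 𝒞
-- inside A with rank B = maxRank A; this makes maxRank submodular.  The excess is
-- submodular as well, except for A, B ∈ 𝒞 with A ∪ B ∉ 𝒞, where CR1 makes the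
-- inequality for maxRank strict.  For part 3, the ranks of 𝒞 determine N because
-- every A ⊆ S contains some B with p ∉ cl B and σ B = σ A.

open import Defs
open import Data.Bool.Base using (if_then_else_)
open import Data.Fin.Base using (Fin; zero; suc)
open import Data.Fin.Properties using (any?)
open import Data.Fin.Subset
  using (Subset; inside; outside; ⊥; _∈_; _∉_; _⊆_; _⊂_; _⊃_; _∪_; _∩_; _─_; ⁅_⁆; ∣_∣)
open import Data.Fin.Subset.Induction using (Acc; acc; ⊃-wellFounded)
open import Data.Fin.Subset.Properties
open import Data.List.Base using (map)
open import Data.List.Extrema.Nat using (argmax-all; v≤max⁺)
import Data.List.Membership.Propositional as List
open import Data.List.Membership.Propositional.Properties using (∈-map⁺; ∈-++⁺ˡ; ∈-++⁺ʳ)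
import Data.List.Relation.Unary.All as All
import Data.List.Relation.Unary.All.Properties as All
import Data.List.Relation.Unary.Any as Any
import Data.List.Relation.Unary.Any.Properties as Any
import Data.Maybe.Base as Maybe
open import Data.Maybe.Relation.Unary.All using (just; nothing) renaming (All to MaybeAll)
open import Data.Maybe.Relation.Unary.Any using (just) renaming (Any to MaybeAny)
open import Data.Nat.Base using (ℕ; suc; _+_; _≤_; _<_; z≤n; s≤s)
open import Data.Nat.Properties
open import Data.Product.Base using (Σ-syntax; ∃-syntax; _×_; _,_; proj₁; proj₂)
open import Data.Sum.Base using (inj₁; inj₂)
open import Data.Vec.Base using ([]; _∷_; tail; here; there)
open import Data.Vec.Properties using ([]=⇒lookup; lookup⇒[]=)
open import Function.Base using (_∘_; id)
open import Function.Definitions using (Congruent; Inverseˡ; Inverseʳ)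
open import Function.Structures using (IsInverse; IsBijection; IsSurjection)
open import Relation.Binary.PropositionalEquality
  using (_≡_; refl; sym; trans; cong; cong₂; subst; subst₂)
open import Relation.Binary.Structures using (IsEquivalence)
open import Relation.Nullary using (Dec; yes; no; does; ¬_; contradiction)
open import Relation.Nullary.Decidable using (_×-dec_; dec⇒maybe; dec-true; dec-false; decidable-stable; map′)
open import Relation.Unary using (Decidable)
import Algebra.Properties.CommutativeSemigroup as CommutativeSemigroup

private
  variable
    m n : ℕ
    e : Fin n
    A B D I U X Y Z : Subset n

-- Subsets of a finite set.

∪-least : X ⊆ Z → Y ⊆ Z → X ∪ Y ⊆ Z
∪-least {X = X} {Y = Y} X⊆Z Y⊆Z x∈ with x∈p∪q⁻ X Y x∈
... | inj₁ x∈X = X⊆Z x∈X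
... | inj₂ x∈Y = Y⊆Z x∈Y

∩-greatest : Z ⊆ X → Z ⊆ Y → Z ⊆ X ∩ Y
∩-greatest Z⊆X Z⊆Y x∈ = x∈p∩q⁺ (Z⊆X x∈ , Z⊆Y x∈)

⁅⁆⊆ : e ∈ X → ⁅ e ⁆ ⊆ X
⁅⁆⊆ {e = e} e∈X x∈ rewrite x∈⁅y⁆⇒x≡y e x∈ = e∈X

x∈p─q⇒x∉q : e ∈ X ─ Y → e ∉ Y
x∈p─q⇒x∉q {X = _ ∷ _} {outside ∷ _} (there e∈) (there e∈Y) = x∈p─q⇒x∉q e∈ e∈Y
x∈p─q⇒x∉q {X = _ ∷ _} {inside  ∷ _} (there e∈) (there e∈Y) = x∈p─q⇒x∉q e∈ e∈Y

⊂-∪⁅⁆ : e ∉ X → X ⊂ X ∪ ⁅ e ⁆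
⊂-∪⁅⁆ {e = e} {X} e∉X = p⊆p∪q ⁅ e ⁆ , e , q⊆p∪q X ⁅ e ⁆ (x∈⁅x⁆ e) , e∉X

-- Strictness is a failed inclusion because `ext-bounded` has no element of the difference at hand:
-- it only knows that `Y ⊆ X` would put `Y` into `𝒞`.
∣∣-strictMono : X ⊆ Y → ¬ Y ⊆ X → ∣ X ∣ < ∣ Y ∣
∣∣-strictMono {X = []}          {[]}          _   Y⊈X = contradiction (λ { {()} }) Y⊈X
∣∣-strictMono {X = outside ∷ _} {outside ∷ _} X⊆Y Y⊈X = ∣∣-strictMono (drop-∷-⊆ X⊆Y) (λ Y⊆X → Y⊈X (s⊆s Y⊆X))
∣∣-strictMono {X = outside ∷ _} {inside  ∷ _} X⊆Y Y⊈X = s≤s (p⊆q⇒∣p∣≤∣q∣ (drop-∷-⊆ X⊆Y))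
∣∣-strictMono {X = inside  ∷ _} {outside ∷ _} X⊆Y Y⊈X = contradiction (X⊆Y here) λ ()
∣∣-strictMono {X = inside  ∷ _} {inside  ∷ _} X⊆Y Y⊈X =
  s≤s (∣∣-strictMono (drop-∷-⊆ X⊆Y) (λ Y⊆X → Y⊈X (s⊆s Y⊆X)))

-- Every set arises from the empty one by adding single elements: first those of the tail, by
-- recursion on the length, and then possibly the first coordinate.
subset-induction : (P : Subset n → Set) → P ⊥ →
                   (∀ Y e → P Y → P (Y ∪ ⁅ e ⁆)) → ∀ Y → P Y
subset-induction P P⊥ step [] = P⊥
subset-induction P P⊥ step (s ∷ Y) = add-head s
  where
  P-outside : P (outside ∷ Y)
  P-outside = subset-induction (P ∘ (outside ∷_)) P⊥
                (λ Z e → step (outside ∷ Z) (suc e)) Y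

  add-head : ∀ s → P (s ∷ Y)
  add-head outside = P-outside
  add-head inside  = subst (λ Z → P (inside ∷ Z)) (∪-identityʳ Y)
                       (step (outside ∷ Y) zero P-outside)

∈-subsets : (A : Subset n) → A List.∈ subsets n
∈-subsets []            = Any.here refl
∈-subsets (outside ∷ A) = ∈-++⁺ˡ (∈-map⁺ (outside ∷_) (∈-subsets A))
∈-subsets (inside  ∷ A) = ∈-++⁺ʳ (map (outside ∷_) (subsets _)) (∈-map⁺ (inside ∷_) (∈-subsets A))

-- Rank functions of matroids.

module MatroidRank {r : Subset m → ℕ} (isMatroidRank : IsMatroidRank r) where
  open IsMatroidRank isMatroidRank

  rank-⊥ : r ⊥ ≡ 0
  rank-⊥ = n≤0⇒n≡0 (subst (r ⊥ ≤_) (∣⊥∣≡0 m) (bounded ⊥))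

  -- Asking only for inclusions saves computing unions and intersections exactly wherever
  -- submodularity is applied.
  submodular-⊆ : ∀ X Y → U ⊆ X ∪ Y → I ⊆ X ∩ Y → r U + r I ≤ r X + r Y
  submodular-⊆ X Y U⊆ I⊆ = ≤-trans (+-mono-≤ (monotone U⊆) (monotone I⊆)) (submodular X Y)

  rank-insert : ∀ X e → r (X ∪ ⁅ e ⁆) ≤ suc (r X)
  rank-insert X e = begin
    r (X ∪ ⁅ e ⁆)                   ≤⟨ m+n≤o⇒m≤o _ (submodular X ⁅ e ⁆) ⟩
    r X + r ⁅ e ⁆                   ≤⟨ +-monoʳ-≤ (r X) (bounded ⁅ e ⁆) ⟩
    r X + ∣ ⁅ e ⁆ ∣                 ≡⟨ cong (r X +_) (∣⁅x⁆∣≡1 e) ⟩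
    r X + 1                         ≡⟨ +-comm (r X) 1 ⟩
    suc (r X)                       ∎
    where open ≤-Reasoning

  -- The elements of `Y` are added one at a time. Since `X ∪ Y` and `X ∪ {e}` both contain `X`,
  -- submodularity lets `e` raise the rank of `X ∪ Y` by no more than that of `X`, hence not at all.
  rank-∪-spanned : ∀ X Y → (∀ {e} → e ∈ Y → r (X ∪ ⁅ e ⁆) ≤ r X) → r (X ∪ Y) ≤ r X
  rank-∪-spanned X = subset-induction
    (λ Y → (∀ {e} → e ∈ Y → r (X ∪ ⁅ e ⁆) ≤ r X) → r (X ∪ Y) ≤ r X)
    (λ _ → ≤-reflexive (cong r (∪-identityʳ X)))
    (λ Y e ih spanned → ≤-trans
      (+-cancelʳ-≤ (r X) _ _ (begin
        r (X ∪ (Y ∪ ⁅ e ⁆)) + r X       ≤⟨ submodular-⊆ (X ∪ Y) (X ∪ ⁅ e ⁆)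
                                             (∪-least (p⊆p∪q _ ∘ p⊆p∪q Y)
                                                (∪-least (p⊆p∪q _ ∘ q⊆p∪q X Y)
                                                         (q⊆p∪q (X ∪ Y) _ ∘ q⊆p∪q X ⁅ e ⁆)))
                                             (∩-greatest (p⊆p∪q Y) (p⊆p∪q ⁅ e ⁆)) ⟩
        r (X ∪ Y) + r (X ∪ ⁅ e ⁆)       ≤⟨ +-monoʳ-≤ (r (X ∪ Y)) (spanned (q⊆p∪q Y ⁅ e ⁆ (x∈⁅x⁆ e))) ⟩
        r (X ∪ Y) + r X                 ∎))
      (ih (spanned ∘ p⊆p∪q ⁅ e ⁆)))
    where open ≤-Reasoning

-- From pointed matroids to semimatroids.

module PointedmatProperties (N : Pointedmat n) where
  open Pointedmat N
  open IsMatroidRank isMatroidRank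
  open MatroidRank isMatroidRank

  ρ σ : Subset n → ℕ
  ρ A = rank (outside ∷ A)
  σ A = rank (inside  ∷ A)

  ρ≤σ : ∀ A → ρ A ≤ σ A
  ρ≤σ A = monotone (out⊆ ⊆-refl)

  insert-p : (A : Subset n) → (outside ∷ A) ∪ ⁅ p ⁆ ≡ inside ∷ A
  insert-p A = cong (inside ∷_) (∪-identityʳ A)

  σ≤1+ρ : ∀ A → σ A ≤ suc (ρ A)
  σ≤1+ρ A = subst (λ B → rank B ≤ suc (ρ A)) (insert-p A) (rank-insert (outside ∷ A) p)

  -- Membership of `p` in `cl` is a Boolean at coordinate `zero`. This lemma and the next trade it
  -- for a comparison of `ρ` and `σ`, the form used from here on.
  avoiding⇒< : avoiding N A → ρ A < σ A
  avoiding⇒< {A = A} avoid = ≤∧≢⇒< (ρ≤σ A) λ ρ≡σ → avoid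
    (lookup⇒[]= zero _ (dec-true (_ ≟ _) (trans (cong rank (insert-p A)) (sym ρ≡σ))))

  <⇒avoiding : ρ A < σ A → avoiding N A
  <⇒avoiding {A = A} ρ<σ p∈cl = contradiction
    (trans (sym (dec-false (_ ≟ _)
      (λ eq → <⇒≢ ρ<σ (sym (trans (cong rank (sym (insert-p A))) eq)))))
      ([]=⇒lookup p∈cl))
    λ ()

  σ-avoiding : avoiding N A → σ A ≡ suc (ρ A)
  σ-avoiding {A = A} avoid = ≤-antisym (σ≤1+ρ A) (avoiding⇒< avoid)

  σ-nonavoiding : ¬ avoiding N A → σ A ≡ ρ A
  σ-nonavoiding {A = A} ¬avoid = ≤-antisym (≮⇒≥ (¬avoid ∘ <⇒avoiding)) (ρ≤σ A)

  avoiding? : Decidable (avoiding N)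
  avoiding? A = map′ <⇒avoiding avoiding⇒< (ρ A <? σ A)

  avoiding-⊥ : avoiding N ⊥
  avoiding-⊥ = <⇒avoiding (subst (_< σ ⊥) (sym rank-⊥) (n≢0⇒n>0 p-nonloop))

  -- By submodularity for `X ∪ {p}` and `Y`, adding `p` raises the rank of the smaller set at least
  -- as much as that of the larger one.
  avoiding-closed : X ⊆ Y → avoiding N Y → avoiding N X
  avoiding-closed {X = X} {Y} X⊆Y avoid = <⇒avoiding (≰⇒> λ σX≤ρX →
    <⇒≱ (avoiding⇒< avoid) (+-cancelʳ-≤ (ρ X) _ _ (begin
      σ Y + ρ X  ≤⟨ submodular-⊆ (inside ∷ X) (outside ∷ Y)
                      (s⊆s (q⊆p∪q X Y)) (out⊆ (∩-greatest ⊆-refl X⊆Y)) ⟩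
      σ X + ρ Y  ≤⟨ +-monoˡ-≤ (ρ Y) σX≤ρX ⟩
      ρ X + ρ Y  ≡⟨ +-comm (ρ X) (ρ Y) ⟩
      ρ Y + ρ X  ∎)))
    where open ≤-Reasoning

  -- If `X ∩ Y` has the rank of `X`, then `X` adds nothing to the rank of `Y`. So `ρ (X ∪ Y)` is
  -- still below `σ Y`.
  avoiding-∪ : avoiding N Y → ρ X ≡ ρ (X ∩ Y) → avoiding N (X ∪ Y)
  avoiding-∪ {Y = Y} {X} avoidY ρX≡ = <⇒avoiding (begin-strict
    ρ (X ∪ Y)  ≤⟨ +-cancelʳ-≤ (ρ X) _ _ (begin
                    ρ (X ∪ Y) + ρ X        ≡⟨ cong (ρ (X ∪ Y) +_) ρX≡ ⟩
                    ρ (X ∪ Y) + ρ (X ∩ Y)  ≤⟨ submodular (outside ∷ X) (outside ∷ Y) ⟩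
                    ρ X + ρ Y              ≡⟨ +-comm (ρ X) (ρ Y) ⟩
                    ρ Y + ρ X              ∎) ⟩
    ρ Y        <⟨ avoiding⇒< avoidY ⟩
    σ Y        ≤⟨ monotone (s⊆s (q⊆p∪q X Y)) ⟩
    σ (X ∪ Y)  ∎)
    where open ≤-Reasoning

  -- If no element of `Y ─ X` worked, all of `Y` would lie in the span of `X ∪ {p}`. The rank of
  -- that set is at most `ρ Y`, whereas `Y ∪ {p}` has a larger one.
  avoiding-augment : avoiding N X → avoiding N Y → ρ X < ρ Y →
                     ∃[ e ] e ∈ Y ─ X × avoiding N (X ∪ ⁅ e ⁆)
  avoiding-augment {X = X} {Y} avoidX avoidY ρX<ρY
    with any? (λ e → (e ∈? Y ─ X) ×-dec avoiding? (X ∪ ⁅ e ⁆))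
  ... | yes found = found
  ... | no ¬found = contradiction (begin-strict
      σ X        ≤⟨ σ≤1+ρ X ⟩
      suc (ρ X)  ≤⟨ ρX<ρY ⟩
      ρ Y        <⟨ avoiding⇒< avoidY ⟩
      σ Y        ≤⟨ monotone (s⊆s (q⊆p∪q X Y)) ⟩
      σ (X ∪ Y)  ≤⟨ rank-∪-spanned (inside ∷ X) (outside ∷ Y) spanned ⟩
      σ X        ∎) (<-irrefl refl)
    where
    open ≤-Reasoning
    spanned : ∀ {e} → e ∈ outside ∷ Y → rank ((inside ∷ X) ∪ ⁅ e ⁆) ≤ σ X
    spanned {suc e} (there e∈Y) with e ∈? X
    ... | yes e∈X = monotone (s⊆s (∪-least ⊆-refl (⁅⁆⊆ e∈X)))
    -- The search rejected `e`, so `p` lies in the closure of `X ∪ {e}`: adding `e` and `p` to `X`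
    -- costs only one unit of rank, which `p` alone already takes.
    ... | no  e∉X = begin
      σ (X ∪ ⁅ e ⁆)  ≡⟨ σ-nonavoiding (λ avoid → ¬found (e , x∈p∧x∉q⇒x∈p─q e∈Y e∉X , avoid)) ⟩
      ρ (X ∪ ⁅ e ⁆)  ≤⟨ rank-insert (outside ∷ X) (suc e) ⟩
      suc (ρ X)      ≡⟨ σ-avoiding avoidX ⟨
      σ X            ∎

  isSemimatroid : IsSemimatroid (avoiding N) (restrictedRank N)
  isSemimatroid = record
    { 𝒞?       = avoiding?
    ; nonEmpty = ⊥ , avoiding-⊥
    ; closed   = avoiding-closed
    ; R1       = λ X _ → bounded (outside ∷ X)
    ; R2       = λ _ _ X⊆Y → monotone (s⊆s X⊆Y)
    ; R3       = λ {X} {Y} _ _ _ → submodular (outside ∷ X) (outside ∷ Y)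
    ; CR1      = λ _ → avoiding-∪
    ; CR2      = avoiding-augment
    }

  -- Passing from A to A ∪ {e}, either B still works, or e adds to the span of
  -- B ∪ {p} and B ∪ {e} does.
  avoiding-spanning : ∀ A → ∃[ B ] B ⊆ A × avoiding N B × σ A ≤ σ B
  avoiding-spanning = subset-induction (λ A → ∃[ B ] B ⊆ A × avoiding N B × σ A ≤ σ B)
    (⊥ , ⊆-refl , avoiding-⊥ , ≤-refl) step
    where
    open ≤-Reasoning
    step : ∀ A e → ∃[ B ] B ⊆ A × avoiding N B × σ A ≤ σ B →
           ∃[ B ] B ⊆ A ∪ ⁅ e ⁆ × avoiding N B × σ (A ∪ ⁅ e ⁆) ≤ σ B
    step A e (B , B⊆A , avoidB , σA≤σB) = choose (σ B <? σ (B ∪ ⁅ e ⁆))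
      where
      -- Adding `e` to `A ∪ {p}` gains at most what adding it to the smaller `B ∪ {p}` gains, and
      -- `σ A ≤ σ B` to begin with.
      σAe≤σBe : σ (A ∪ ⁅ e ⁆) ≤ σ (B ∪ ⁅ e ⁆)
      σAe≤σBe = +-cancelˡ-≤ (σ B) _ _ (begin
        σ B + σ (A ∪ ⁅ e ⁆)  ≡⟨ +-comm (σ B) _ ⟩
        σ (A ∪ ⁅ e ⁆) + σ B  ≤⟨ submodular-⊆ (inside ∷ A) (inside ∷ (B ∪ ⁅ e ⁆))
                                  (s⊆s (∪-least (p⊆p∪q _) (q⊆p∪q A _ ∘ q⊆p∪q B _)))
                                  (s⊆s (∩-greatest B⊆A (p⊆p∪q _))) ⟩
        σ A + σ (B ∪ ⁅ e ⁆)  ≤⟨ +-monoˡ-≤ _ σA≤σB ⟩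
        σ B + σ (B ∪ ⁅ e ⁆)  ∎)

      choose : Dec (σ B < σ (B ∪ ⁅ e ⁆)) →
               ∃[ B ] B ⊆ A ∪ ⁅ e ⁆ × avoiding N B × σ (A ∪ ⁅ e ⁆) ≤ σ B
      choose (no σB≮σBe) = B , p⊆p∪q _ ∘ B⊆A , avoidB , ≤-trans σAe≤σBe (≮⇒≥ σB≮σBe)
      choose (yes σB<σBe) =
        B ∪ ⁅ e ⁆ , ∪-least (p⊆p∪q _ ∘ B⊆A) (q⊆p∪q A _) , <⇒avoiding (begin-strict
          ρ (B ∪ ⁅ e ⁆)  ≤⟨ rank-insert (outside ∷ B) (suc e) ⟩
          suc (ρ B)      ≡⟨ σ-avoiding avoidB ⟨
          σ B            <⟨ σB<σBe ⟩
          σ (B ∪ ⁅ e ⁆)  ∎) , σAe≤σBe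

-- From semimatroids to pointed matroids.

module SemimatProperties (M : Semimat n) where
  open Semimat M

  R : Subset n → ℕ
  R = maxRank M

  ext : Subset (suc n) → ℕ
  ext = extendedRank M

  𝒞-⊥ : 𝒞 ⊥
  𝒞-⊥ = closed (⊆-min _) (proj₂ nonEmpty)

  rank-⊥ : rank ⊥ 𝒞-⊥ ≡ 0
  rank-⊥ = n≤0⇒n≡0 (subst (rank ⊥ 𝒞-⊥ ≤_) (∣⊥∣≡0 n) (R1 ⊥ 𝒞-⊥))

  maxRank-upper : B ⊆ A → (c : 𝒞 B) → rank B c ≤ R A
  maxRank-upper {B = B} {A} B⊆A c = v≤max⁺ 0 _
    (inj₂ (Any.mapMaybe⁺ _ (subsets n)
      (Any.map⁺ (Any.map (λ { refl → attains (B ⊆? A ×-dec 𝒞? B) }) (∈-subsets B)))))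
    where
    attains : (d : Dec (B ⊆ A × 𝒞 B)) →
              MaybeAny (rank B c ≤_) (Maybe.map (λ (_ , c) → rank B c) (dec⇒maybe d))
    -- The decision may carry another membership proof than `c`. The ranks agree because `rank`
    -- ignores that proof.
    attains (yes _) = just ≤-refl
    attains (no ¬d) = contradiction ((λ {x} → B⊆A {x}) , c) ¬d

  maxRank-attained : ∀ A → ∃[ B ] B ⊆ A × Σ[ c ∈ 𝒞 B ] rank B c ≡ R A
  maxRank-attained A = argmax-all id {P = λ k → ∃[ B ] B ⊆ A × Σ[ c ∈ 𝒞 B ] rank B c ≡ k}
    -- The default value 0 of `max` is attained too, as the rank of the empty set.
    (⊥ , ⊆-min A , 𝒞-⊥ , rank-⊥)
    (All.mapMaybe⁺ (All.map⁺ (All.universal (λ B → witness B (B ⊆? A ×-dec 𝒞? B)) (subsets n))))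
    where
    witness : ∀ B (d : Dec (B ⊆ A × 𝒞 B)) →
              MaybeAll (λ k → ∃[ B ] B ⊆ A × Σ[ c ∈ 𝒞 B ] rank B c ≡ k)
                       (Maybe.map (λ (_ , c) → rank B c) (dec⇒maybe d))
    witness B (yes (B⊆A , c)) = just (B , B⊆A , c , refl)
    witness B (no _)          = nothing

  maxRank-𝒞 : (c : 𝒞 A) → R A ≡ rank A c
  maxRank-𝒞 {A = A} c with B , B⊆A , b , rB≡ ← maxRank-attained A =
    ≤-antisym (subst (_≤ rank A c) rB≡ (R2 b c B⊆A)) (maxRank-upper ⊆-refl c)

  maxRank-mono : A ⊆ B → R A ≤ R B
  maxRank-mono {A = A} {B} A⊆B with D , D⊆A , d , rD≡ ← maxRank-attained A =
    subst (_≤ R B) rD≡ (maxRank-upper (A⊆B ∘ D⊆A) d)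

  R3-⊆ : (x : 𝒞 X) (y : 𝒞 Y) (u : 𝒞 U) (i : 𝒞 I) → 𝒞 (X ∪ Y) →
         U ⊆ X ∪ Y → I ⊆ X ∩ Y → rank U u + rank I i ≤ rank X x + rank Y y
  R3-⊆ x y u i xy U⊆ I⊆ = ≤-trans (+-mono-≤ (R2 u xy U⊆) (R2 i (closed (p∩q⊆p _ _) x) I⊆)) (R3 x y xy)

  -- While `D` has smaller rank than some `T ⊆ A` of maximal rank, CR2 adds an element of `T` to it.
  -- The recursion is on the growing set and not on its rank, since CR2 does not promise that the
  -- rank rises.
  extend-to-basis : D ⊆ A → 𝒞 D →
                    ∃[ B ] D ⊆ B × B ⊆ A × Σ[ b ∈ 𝒞 B ] rank B b ≡ R A
  extend-to-basis {D = D} {A} = go D (⊃-wellFounded D)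
    where
    go : ∀ D → Acc _⊃_ D → D ⊆ A → 𝒞 D →
         ∃[ B ] D ⊆ B × B ⊆ A × Σ[ b ∈ 𝒞 B ] rank B b ≡ R A
    go D (acc rec) D⊆A d with maxRank-attained A
    ... | T , T⊆A , t , rT≡ with rank D d <? rank T t
    ...   | no rD≮rT = D , ⊆-refl , D⊆A , d ,
              ≤-antisym (maxRank-upper D⊆A d) (subst (_≤ rank D d) rT≡ (≮⇒≥ rD≮rT))
    ...   | yes rD<rT with e , e∈T─D , de ← CR2 d t rD<rT
                    with B , De⊆B , rest ← go (D ∪ ⁅ e ⁆) (rec (⊂-∪⁅⁆ (x∈p─q⇒x∉q e∈T─D)))
                           (∪-least D⊆A (⁅⁆⊆ (T⊆A (p─q⊆p T D e∈T─D)))) de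
              = B , De⊆B ∘ p⊆p∪q ⁅ e ⁆ , rest

  -- A maximizer `I` for `A ∩ B` is extended to a maximizer `J` for `A ∪ B`. R3 then applies to
  -- `A ∩ J` and `B ∩ J`, which cover `J`, both contain `I`, and have their union inside `J`.
  maxRank-submodular : ∀ A B → R (A ∪ B) + R (A ∩ B) ≤ R A + R B
  maxRank-submodular A B
    with I , I⊆A∩B , i , rI≡ ← maxRank-attained (A ∩ B)
    with J , I⊆J , J⊆A∪B , j , rJ≡ ←
           extend-to-basis {A = A ∪ B} (p⊆p∪q B ∘ p∩q⊆p A B ∘ I⊆A∩B) i
    = begin
      R (A ∪ B) + R (A ∩ B)              ≡⟨ cong₂ _+_ rJ≡ rI≡ ⟨
      rank J j + rank I i                ≤⟨ R3-⊆ (closed (p∩q⊆q A J) j) (closed (p∩q⊆q B J) j) j i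
                                              (closed (∪-least (p∩q⊆q A J) (p∩q⊆q B J)) j)
                                              J⊆
                                              (∩-greatest (∩-greatest (p∩q⊆p A B ∘ I⊆A∩B) I⊆J)
                                                          (∩-greatest (p∩q⊆q A B ∘ I⊆A∩B) I⊆J)) ⟩
      rank (A ∩ J) _ + rank (B ∩ J) _    ≤⟨ +-mono-≤ (maxRank-upper (p∩q⊆p A J) (closed (p∩q⊆q A J) j))
                                                     (maxRank-upper (p∩q⊆p B J) (closed (p∩q⊆q B J) j)) ⟩
      R A + R B                          ∎
    where
    open ≤-Reasoning
    J⊆ : J ⊆ (A ∩ J) ∪ (B ∩ J)
    J⊆ x∈J with x∈p∪q⁻ A B (J⊆A∪B x∈J)
    ... | inj₁ x∈A = p⊆p∪q _ (x∈p∩q⁺ (x∈A , x∈J))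
    ... | inj₂ x∈B = q⊆p∪q (A ∩ J) _ (x∈p∩q⁺ (x∈B , x∈J))

  -- Now `A` itself is extended to a maximizer `J` for `A ∪ B`, and R3 is applied to `A` and
  -- `B ∩ J`. The strictness comes from the rank lost between `B` and `B ∩ J`.
  maxRank-submodular-strict : 𝒞 A → 𝒞 B → ¬ 𝒞 (A ∪ B) → R (A ∪ B) + R (A ∩ B) < R A + R B
  maxRank-submodular-strict {A = A} {B} a b ¬ab
    with J , A⊆J , J⊆A∪B , j , rJ≡ ← extend-to-basis {A = A ∪ B} (p⊆p∪q B) a
    = begin-strict
      R (A ∪ B) + R (A ∩ B)          ≡⟨ cong₂ _+_ (sym rJ≡) (maxRank-𝒞 (closed (p∩q⊆p A B) a)) ⟩
      rank J j + rank (A ∩ B) _      ≤⟨ R3-⊆ a bj j (closed (p∩q⊆p A B) a)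
                                          (closed (∪-least A⊆J (p∩q⊆q B J)) j)
                                          J⊆
                                          (∩-greatest (p∩q⊆p A B)
                                            (∩-greatest (p∩q⊆q A B) (A⊆J ∘ p∩q⊆p A B))) ⟩
      rank A a + rank (B ∩ J) bj     <⟨ +-monoʳ-< (rank A a) rBJ<rB ⟩
      rank A a + rank B b            ≡⟨ cong₂ _+_ (maxRank-𝒞 a) (maxRank-𝒞 b) ⟨
      R A + R B                      ∎
    where
    open ≤-Reasoning
    bj : 𝒞 (B ∩ J)
    bj = closed (p∩q⊆p B J) b

    -- CR1 would otherwise put B ∪ J ⊇ A ∪ B into 𝒞.
    rBJ<rB : rank (B ∩ J) bj < rank B b
    rBJ<rB = ≤∧≢⇒< (R2 bj b (p∩q⊆p B J)) λ eq →
      ¬ab (closed (∪-least (q⊆p∪q B J ∘ A⊆J) (p⊆p∪q J)) (CR1 b j (sym eq)))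

    J⊆ : J ⊆ A ∪ (B ∩ J)
    J⊆ x∈J with x∈p∪q⁻ A B (J⊆A∪B x∈J)
    ... | inj₁ x∈A = p⊆p∪q _ x∈A
    ... | inj₂ x∈B = q⊆p∪q A _ (x∈p∩q⁺ (x∈B , x∈J))

  -- In the extended matroid, this tells whether `p` lies in the closure of the set, while `R` is
  -- the rank function of the contraction by `p`. Their sum is `ext`.
  excess : Subset (suc n) → ℕ
  excess (inside  ∷ A) = 1
  excess (outside ∷ A) = if does (𝒞? A) then 0 else 1

  excess-𝒞 : 𝒞 A → excess (outside ∷ A) ≡ 0
  excess-𝒞 {A = A} c rewrite dec-true (𝒞? A) c = refl

  excess-∉𝒞 : ¬ 𝒞 A → excess (outside ∷ A) ≡ 1
  excess-∉𝒞 {A = A} ¬c rewrite dec-false (𝒞? A) ¬c = refl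

  excess≤1 : ∀ X → excess X ≤ 1
  excess≤1 (inside  ∷ A) = ≤-refl
  excess≤1 (outside ∷ A) with 𝒞? A
  ... | yes _ = z≤n
  ... | no  _ = ≤-refl

  excess-mono : X ⊆ Y → excess X ≤ excess Y
  excess-mono {X = X} {inside ∷ B} _ = excess≤1 X
  excess-mono {X = inside ∷ A} {outside ∷ B} X⊆Y = contradiction (X⊆Y here) λ ()
  excess-mono {X = outside ∷ A} {outside ∷ B} X⊆Y with 𝒞? B
  ... | yes b = ≤-reflexive (excess-𝒞 (closed (drop-∷-⊆ X⊆Y) b))
  ... | no  _ = excess≤1 (outside ∷ A)

  ext-outside : ∀ A → ext (outside ∷ A) ≡ excess (outside ∷ A) + R A
  ext-outside A with 𝒞? A
  ... | yes c = sym (maxRank-𝒞 c)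
  ... | no  _ = +-comm (R A) 1

  ext-inside : ∀ A → ext (inside ∷ A) ≡ suc (R A)
  ext-inside A with 𝒞? A
  ... | yes c = trans (cong (_+ 1) (trans (ext-outside A) (cong (_+ R A) (excess-𝒞 c)))) (+-comm (R A) 1)
  ... | no ¬c = trans (ext-outside A) (cong (_+ R A) (excess-∉𝒞 ¬c))

  ext≡ : ∀ X → ext X ≡ excess X + R (tail X)
  ext≡ (outside ∷ A) = ext-outside A
  ext≡ (inside  ∷ A) = ext-inside A

  ext-𝒞 : (c : 𝒞 A) → ext (outside ∷ A) ≡ rank A c × ext (inside ∷ A) ≡ rank A c + 1
  ext-𝒞 {A = A} c =
      trans (ext-outside A) (trans (cong (_+ R A) (excess-𝒞 c)) (maxRank-𝒞 c))
    , trans (ext-inside A) (trans (cong suc (maxRank-𝒞 c)) (+-comm 1 _))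

  ext-∉𝒞 : ¬ 𝒞 A → ext (outside ∷ A) ≡ R A + 1 × ext (inside ∷ A) ≡ R A + 1
  ext-∉𝒞 {A = A} ¬c =
      trans (ext-outside A) (trans (cong (_+ R A) (excess-∉𝒞 ¬c)) (+-comm 1 _))
    , trans (ext-inside A) (+-comm 1 _)

  -- The added 1 is paid for by `p` if the set contains it. Otherwise it occurs only for `A` outside
  -- `𝒞`, where a maximizer `B`, being in `𝒞`, is a proper subset of `A`.
  ext-bounded : ∀ X → ext X ≤ ∣ X ∣
  ext-bounded (s ∷ A) with maxRank-attained A
  ext-bounded (inside ∷ A) | B , B⊆A , b , rB≡ = begin
      ext (inside ∷ A)  ≡⟨ ext-inside A ⟩
      suc (R A)         ≡⟨ cong suc rB≡ ⟨
      suc (rank B b)    ≤⟨ s≤s (R1 B b) ⟩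
      suc ∣ B ∣         ≤⟨ s≤s (p⊆q⇒∣p∣≤∣q∣ B⊆A) ⟩
      suc ∣ A ∣         ∎
    where open ≤-Reasoning
  ext-bounded (outside ∷ A) | B , B⊆A , b , rB≡ with 𝒞? A
  ... | yes a = R1 A a
  ... | no ¬a = begin
      R A + 1           ≡⟨ +-comm (R A) 1 ⟩
      suc (R A)         ≡⟨ cong suc rB≡ ⟨
      suc (rank B b)    ≤⟨ s≤s (R1 B b) ⟩
      suc ∣ B ∣         ≤⟨ ∣∣-strictMono B⊆A (λ A⊆B → ¬a (closed A⊆B b)) ⟩
      ∣ A ∣             ∎
    where open ≤-Reasoning

  ext-monotone : X ⊆ Y → ext X ≤ ext Y
  ext-monotone {X = X@(_ ∷ A)} {Y@(_ ∷ B)} X⊆Y = begin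
    ext X          ≡⟨ ext≡ X ⟩
    excess X + R A ≤⟨ +-mono-≤ (excess-mono X⊆Y) (maxRank-mono (drop-∷-⊆ X⊆Y)) ⟩
    excess Y + R B ≡⟨ ext≡ Y ⟨
    ext Y          ∎
    where open ≤-Reasoning

  excess-submodular⇒ext-submodular : ∀ X Y →
    excess (X ∪ Y) + excess (X ∩ Y) ≤ excess X + excess Y →
    ext (X ∪ Y) + ext (X ∩ Y) ≤ ext X + ext Y
  excess-submodular⇒ext-submodular X@(_ ∷ A) Y@(_ ∷ B) excess-≤ = begin
    ext (X ∪ Y) + ext (X ∩ Y)
      ≡⟨ cong₂ _+_ (ext≡ (X ∪ Y)) (ext≡ (X ∩ Y)) ⟩
    (excess (X ∪ Y) + R (A ∪ B)) + (excess (X ∩ Y) + R (A ∩ B))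
      ≡⟨ interchange (excess (X ∪ Y)) _ _ _ ⟩
    (excess (X ∪ Y) + excess (X ∩ Y)) + (R (A ∪ B) + R (A ∩ B))
      ≤⟨ +-mono-≤ excess-≤ (maxRank-submodular A B) ⟩
    (excess X + excess Y) + (R A + R B)
      ≡⟨ interchange (excess X) _ _ _ ⟩
    (excess X + R A) + (excess Y + R B)
      ≡⟨ cong₂ _+_ (ext≡ X) (ext≡ Y) ⟨
    ext X + ext Y ∎
    where
    open ≤-Reasoning
    open CommutativeSemigroup +-commutativeSemigroup using (interchange)

  -- The excess never exceeds 1, so that of `X` covers the union, and by monotonicity that of `Y`
  -- covers the intersection.
  excess-submodularˡ : ∀ X Y → excess X ≡ 1 →
                       excess (X ∪ Y) + excess (X ∩ Y) ≤ excess X + excess Y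
  excess-submodularˡ X Y eq =
    +-mono-≤ (subst (excess (X ∪ Y) ≤_) (sym eq) (excess≤1 (X ∪ Y))) (excess-mono (p∩q⊆q X Y))

  excess-submodularʳ : ∀ X Y → excess Y ≡ 1 →
                       excess (X ∪ Y) + excess (X ∩ Y) ≤ excess X + excess Y
  excess-submodularʳ X Y eq = subst (_≤ excess X + excess Y) (+-comm (excess (X ∩ Y)) _)
    (+-mono-≤ (excess-mono (p∩q⊆p X Y)) (subst (excess (X ∪ Y) ≤_) (sym eq) (excess≤1 (X ∪ Y))))

  ext-submodular : ∀ X Y → ext (X ∪ Y) + ext (X ∩ Y) ≤ ext X + ext Y
  ext-submodular X@(inside  ∷ _) Y =
    excess-submodular⇒ext-submodular X Y (excess-submodularˡ X Y refl)
  ext-submodular X@(outside ∷ _) Y@(inside ∷ _) =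
    excess-submodular⇒ext-submodular X Y (excess-submodularʳ X Y refl)
  ext-submodular X@(outside ∷ A) Y@(outside ∷ B) = cases (𝒞? A) (𝒞? B) (𝒞? (A ∪ B))
    where
    open ≤-Reasoning
    cases : Dec (𝒞 A) → Dec (𝒞 B) → Dec (𝒞 (A ∪ B)) →
            ext (X ∪ Y) + ext (X ∩ Y) ≤ ext X + ext Y
    cases (no ¬a) _ _ =
      excess-submodular⇒ext-submodular X Y (excess-submodularˡ X Y (excess-∉𝒞 ¬a))
    cases _ (no ¬b) _ =
      excess-submodular⇒ext-submodular X Y (excess-submodularʳ X Y (excess-∉𝒞 ¬b))
    cases (yes a) _ (yes ab) =
      excess-submodular⇒ext-submodular X Y (subst (_≤ excess X + excess Y)
        (sym (cong₂ _+_ (excess-𝒞 ab) (excess-𝒞 (closed (p∩q⊆p A B) a)))) z≤n)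
    -- The excesses add up to 1 on the left and 0 on the right. The strict inequality for `maxRank`
    -- absorbs the difference.
    cases (yes a) (yes b) (no ¬ab) = begin
      ext (X ∪ Y) + ext (X ∩ Y)                  ≡⟨ cong₂ _+_ (ext≡ (X ∪ Y)) (ext≡ (X ∩ Y)) ⟩
      (excess (X ∪ Y) + R (A ∪ B)) + (excess (X ∩ Y) + R (A ∩ B))
        ≡⟨ cong₂ (λ k l → (k + R (A ∪ B)) + (l + R (A ∩ B)))
             (excess-∉𝒞 ¬ab) (excess-𝒞 (closed (p∩q⊆p A B) a)) ⟩
      suc (R (A ∪ B) + R (A ∩ B))                ≤⟨ maxRank-submodular-strict a b ¬ab ⟩
      R A + R B
        ≡⟨ cong₂ (λ k l → (k + R A) + (l + R B)) (excess-𝒞 a) (excess-𝒞 b) ⟨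
      (excess X + R A) + (excess Y + R B)        ≡⟨ cong₂ _+_ (ext≡ X) (ext≡ Y) ⟨
      ext X + ext Y                              ∎

  isMatroidRank : IsMatroidRank ext
  isMatroidRank = record
    { bounded = ext-bounded ; monotone = ext-monotone ; submodular = ext-submodular }

  p-nonloop : ¬ Matroid.IsLoop (extendedMatroid M isMatroidRank) p
  p-nonloop eq = 1+n≢0 (trans (sym (ext-inside ⊥)) eq)

-- The one-to-one correspondence.

≈ᵖ-isEquivalence : IsEquivalence (_≈ᵖ_ {n})
≈ᵖ-isEquivalence = record
  { refl  = λ _ → refl
  ; sym   = λ N≈N′ X → sym (N≈N′ X)
  ; trans = λ N≈N′ N′≈N″ X → trans (N≈N′ X) (N′≈N″ X)
  }

≈ˢ-isEquivalence : IsEquivalence (_≈ˢ_ {n})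
≈ˢ-isEquivalence = record
  { refl  = (id , id) , λ _ _ _ → refl
  ; sym   = λ ((to , from) , ranks) → (from , to) , λ X c c′ → sym (ranks X c′ c)
  ; trans = λ ((to , from) , ranks) ((to′ , from′) , ranks′) →
      (to′ ∘ to , from ∘ from′) , λ X c c″ → trans (ranks X c (to c)) (ranks′ X (to c) c″)
  }

toSemimat : Pointedmat n → Semimat n
toSemimat N = semimatroidOf N (PointedmatProperties.isSemimatroid N)

toPointedmat : Semimat n → Pointedmat n
toPointedmat M = pointedmatOf M (SemimatProperties.isMatroidRank M) (SemimatProperties.p-nonloop M)

toPointedmat-hasRank : (M : Semimat n) → HasRankGivenBy M (toPointedmat M)
toPointedmat-hasRank M A = SemimatProperties.ext-𝒞 M , SemimatProperties.ext-∉𝒞 M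

-- The two cases of the formula are exhaustive because `𝒞` is decidable. One inverse law and
-- injectivity both rest on this.
hasRank-unique : (M : Semimat n) {N N′ : Pointedmat n} →
                 HasRankGivenBy M N → HasRankGivenBy M N′ → N ≈ᵖ N′
hasRank-unique M h h′ (s ∷ A) with Semimat.𝒞? M A
hasRank-unique M h h′ (outside ∷ A) | yes c =
  trans (proj₁ (proj₁ (h A) c)) (sym (proj₁ (proj₁ (h′ A) c)))
hasRank-unique M h h′ (inside  ∷ A) | yes c =
  trans (proj₂ (proj₁ (h A) c)) (sym (proj₂ (proj₁ (h′ A) c)))
hasRank-unique M h h′ (outside ∷ A) | no ¬c =
  trans (proj₁ (proj₂ (h A) ¬c)) (sym (proj₁ (proj₂ (h′ A) ¬c)))
hasRank-unique M h h′ (inside  ∷ A) | no ¬c =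
  trans (proj₂ (proj₂ (h A) ¬c)) (sym (proj₂ (proj₂ (h′ A) ¬c)))

-- The formula makes `σ` exceed `ρ` by 1 on `𝒞` and agree with it elsewhere, so avoiding `p` amounts
-- to lying in `𝒞`.
hasRank⇒≈ˢ : (M : Semimat n) (N : Pointedmat n) → HasRankGivenBy M N → toSemimat N ≈ˢ M
hasRank⇒≈ˢ M N h =
    ( (λ {A} avoid → decidable-stable (𝒞? A) λ ¬c →
        <-irrefl (trans (proj₁ (proj₂ (h A) ¬c)) (sym (proj₂ (proj₂ (h A) ¬c)))) (avoiding⇒< avoid))
    , λ {A} c → <⇒avoiding (≤-reflexive (trans (+-comm 1 _)
        (trans (cong (_+ 1) (proj₁ (proj₁ (h A) c))) (sym (proj₂ (proj₁ (h A) c)))))))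
  , λ A _ c → proj₁ (proj₁ (h A) c)
  where
  open Semimat M
  open PointedmatProperties N

-- The point is that `σ A` is `R A + 1` for every `A`: `avoiding-spanning` supplies a set that
-- bounds it above, and a maximizer for `R A` bounds it below. Outside `𝒞`, `ρ A` equals `σ A`.
≈ˢ⇒hasRank : (M : Semimat n) (N : Pointedmat n) → M ≈ˢ toSemimat N → HasRankGivenBy M N
≈ˢ⇒hasRank M N ((to , from) , ranks) A =
    (λ c → sym (ranks A c (to c))
         , trans (σ-avoiding (to c)) (trans (+-comm 1 _) (cong (_+ 1) (sym (ranks A c (to c))))))
  , λ ¬c → trans (sym (σ-nonavoiding (¬c ∘ from))) σA≡ , σA≡
  where
  open Semimat M
  open SemimatProperties M
  open PointedmatProperties N
  open ≤-Reasoning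

  σA≤ : σ A ≤ suc (R A)
  σA≤ with B , B⊆A , avoidB , σA≤σB ← avoiding-spanning A = begin
    σ A                          ≤⟨ σA≤σB ⟩
    σ B                          ≡⟨ σ-avoiding avoidB ⟩
    suc (ρ B)                    ≡⟨ cong suc (ranks B (from avoidB) avoidB) ⟨
    suc (rank B (from avoidB))   ≤⟨ s≤s (maxRank-upper B⊆A (from avoidB)) ⟩
    suc (R A)                    ∎

  ≤σA : suc (R A) ≤ σ A
  ≤σA with B , B⊆A , b , rB≡ ← maxRank-attained A = begin
    suc (R A)       ≡⟨ cong suc rB≡ ⟨
    suc (rank B b)  ≡⟨ cong suc (ranks B b (to b)) ⟩
    suc (ρ B)       ≡⟨ σ-avoiding (to b) ⟨
    σ B             ≤⟨ IsMatroidRank.monotone (Pointedmat.isMatroidRank N) (s⊆s B⊆A) ⟩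
    σ A             ∎

  σA≡ : σ A ≡ R A + 1
  σA≡ = trans (≤-antisym σA≤ ≤σA) (+-comm 1 (R A))

avoiding-resp-≈ᵖ : (N N′ : Pointedmat n) → N ≈ᵖ N′ → avoiding N A → avoiding N′ A
avoiding-resp-≈ᵖ N N′ N≈N′ avoid = PointedmatProperties.<⇒avoiding N′
  (subst₂ _<_ (N≈N′ _) (N≈N′ _) (PointedmatProperties.avoiding⇒< N avoid))

toSemimat-cong : Congruent (_≈ᵖ_ {n}) _≈ˢ_ toSemimat
toSemimat-cong {x = N} {N′} N≈N′ =
    (avoiding-resp-≈ᵖ N N′ N≈N′ , avoiding-resp-≈ᵖ N′ N (λ X → sym (N≈N′ X)))
  , λ A _ _ → N≈N′ (outside ∷ A)

-- The law quantifies over every `N` equivalent to `toPointedmat M`, so congruence first replaces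
-- `N` by `toPointedmat M`.
inverseˡ : Inverseˡ (_≈ᵖ_ {n}) _≈ˢ_ toSemimat toPointedmat
inverseˡ {x = M} {N} N≈ = IsEquivalence.trans ≈ˢ-isEquivalence
  {toSemimat N} {toSemimat (toPointedmat M)} {M}
  (toSemimat-cong {x = N} {toPointedmat M} N≈)
  (hasRank⇒≈ˢ M (toPointedmat M) (toPointedmat-hasRank M))

inverseʳ : Inverseʳ (_≈ᵖ_ {n}) _≈ˢ_ toSemimat toPointedmat
inverseʳ {x = N} {M} M≈ =
  hasRank-unique M {toPointedmat M} {N} (toPointedmat-hasRank M) (≈ˢ⇒hasRank M N M≈)

-- Since `M` is equivalent to `M′`, it is equivalent to the semimatroid of `toPointedmat M′`, and
-- `inverseʳ` applies.
toPointedmat-cong : Congruent (_≈ˢ_ {n}) _≈ᵖ_ toPointedmat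
toPointedmat-cong {x = M} {M′} M≈M′ = inverseʳ {x = toPointedmat M′} {M}
  (≈ˢ.trans {M} {M′} {toSemimat (toPointedmat M′)} M≈M′
    (≈ˢ.sym {toSemimat (toPointedmat M′)} {M′}
      (hasRank⇒≈ˢ M′ (toPointedmat M′) (toPointedmat-hasRank M′))))
  where module ≈ˢ = IsEquivalence ≈ˢ-isEquivalence

isInverse : IsInverse (_≈ᵖ_ {n}) _≈ˢ_ toSemimat toPointedmat
isInverse = record
  { isLeftInverse = record
    { isCongruent = record
      { cong           = λ {N} {N′} → toSemimat-cong {x = N} {N′}
      ; isEquivalence₁ = ≈ᵖ-isEquivalence
      ; isEquivalence₂ = ≈ˢ-isEquivalence
      }
    ; from-cong = λ {M} {M′} → toPointedmat-cong {x = M} {M′}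
    ; inverseˡ  = λ {M} {N} → inverseˡ {x = M} {N}
    }
  ; inverseʳ = λ {N} {M} → inverseʳ {x = N} {M}
  }

isBijection : IsBijection (_≈ᵖ_ {n}) _≈ˢ_ toSemimat
isBijection = record
  { isInjection = record
    { isCongruent = isCongruent
    -- Both `N` and `N′` have the ranks prescribed by the single semimatroid `toSemimat N`.
    ; injective   = λ {N} {N′} fN≈fN′ → hasRank-unique (toSemimat N) {N} {N′}
        (≈ˢ⇒hasRank (toSemimat N) N (Eq₂.refl {toSemimat N}))
        (≈ˢ⇒hasRank (toSemimat N) N′ fN≈fN′)
    }
  ; surjective = IsSurjection.surjective isSurjection
  }
  where open IsInverse isInverse using (isCongruent; isSurjection; module Eq₂)

theorem5p4 : ∀ (n : ℕ) →
    Σ[ part₁ ∈ (∀ (N : Pointedmat n) → IsSemimatroid (avoiding N) (restrictedRank N)) ]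
    Σ[ part₂ ∈ (∀ (M : Semimat n) →
    Σ[ h ∈ IsMatroidRank (extendedRank M) ]
    ¬ Matroid.IsLoop (extendedMatroid M h) p) ]
    (∀ (M : Semimat n) →
    HasRankGivenBy M (pointedmatOf M (proj₁ (part₂ M)) (proj₂ (part₂ M))))
    × IsInverse _≈ᵖ_ _≈ˢ_
    (λ N → semimatroidOf N (part₁ N))
    (λ M → pointedmatOf M (proj₁ (part₂ M)) (proj₂ (part₂ M)))
    × IsBijection _≈ᵖ_ _≈ˢ_ (λ N → semimatroidOf N (part₁ N))
theorem5p4 n =
    PointedmatProperties.isSemimatroid
  , (λ M → SemimatProperties.isMatroidRank M , SemimatProperties.p-nonloop M)
  , toPointedmat-hasRank
  , isInverse
  , isBijection
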